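{- Let $\lambda$ be a regular uncountable cardinal and suppose $\square(\lambda,<\omega)$ holds. Then for every stationary $S\subseteq\lambda$, $\mathrm{Refl}(2,S)$ fails; that is, there are two stationary subsets of $S$ that do not reflect simultaneously.
   Context: For a set of ordinals $A$, $\mathrm{acc}(A)$ is the set of $\beta<\sup\{\alpha+1\mid\alpha\in A\}$ with $\beta=\sup(A\cap\beta)$. A coherent sequence of length $\lambda$ and width $<\eta$ is $\mathcal{C}=\langle\mathcal{C}_\alpha\mid\alpha<\lambda\rangle$ where each $\mathcal{C}_\alpha$ is a nonempty set of fewer than $\eta$ closed unbounded subsets of $\alpha$ (for successor $\alpha=\beta+1$, $\mathcal{C}_\alpha=\{\{\beta\}\}$), such that for all $\beta<\lambda$, $C\in\mathcal{C}_\beta$ and $\alpha\in\mathrm{acc}(C)$, $C\cap\alpha\in\mathcal{C}_\alpha$. A thread is a club $D\subseteq\lambda$ with $D\cap\alpha\in\mathcal{C}_\alpha$ for all $\alpha\in\mathrm{acc}(D)$. $\square(\lambda,<\eta)$ asserts the existence of a coherent sequence of length $\lambda$ and width $<\eta$ with no thread; so $\square(\lambda,<\omega)$ concerns sequences with each $\mathcal{C}_\alpha$ finite. A stationary $S\subseteq\lambda$ reflects at $\alpha<\lambda$ if $\mathrm{cf}(\alpha)>\omega$ and $S\cap\alpha$ is stationary in $\alpha$; a collection of stationary sets reflects simultaneously if there is one $\alpha<\lambda$ at which all of them reflect. $\mathrm{Refl}(<\kappa,S)$ says every collection of fewer than $\kappa$ stationary subsets of $S$ reflects simultaneously; $\mathrm{Refl}(\kappa,S)$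 means $\mathrm{Refl}(<\kappa^+,S)$. -}

module Defs where

open import Data.Fin.Base as Fin using (Fin)
import Data.Fin.Induction as Fin
import Data.Fin.Properties as Fin
open import Data.Nat.Base as ℕ using (ℕ)
import Data.Nat.Induction as ℕ
import Data.Nat.Properties as ℕ
open import Data.Product.Base using (Σ; Σ-syntax; ∃-syntax; _×_; _,_; proj₁; proj₂)
open import Data.Sum.Base using (_⊎_)
open import Function.Base using (_on_; _∘_)
open import Function.Bundles using (Injection; _↣_)
open import Induction.WellFounded using (WellFounded)
open import Level using (Level; 0ℓ; suc; _⊔_)
open import Relation.Binary.Bundles using (Setoid)
import Relation.Binary.Construct.Add.Supremum.Strict as AddSupremum
import Relation.Binary.Construct.On as On
open import Relation.Binary.Core using (Rel)
open import Relation.Binary.Definitions using (Irrelevant; Trichotomous; tri<; tri≈; tri>; _Respects_)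
open import Relation.Binary.Morphism.Structures using (IsOrderIsomorphism)
open import Relation.Binary.PropositionalEquality.Core using (_≡_; refl; cong)
import Relation.Binary.PropositionalEquality.Properties as ≡
open import Relation.Binary.Structures using (IsStrictTotalOrder)
open import Relation.Nullary.Construct.Add.Supremum using (_⁺; [_]; ⊤⁺)
open import Relation.Nullary.Negation.Core using (¬_)
open import Relation.Unary using (Pred; _∈_; _⊆_; _∩_; _≐_; ｛_｝; Satisfiable)
open import Relation.Unary.Relation.Binary.Equality using (≐-setoid)

private
  variable
    ℓ ℓ′ : Level

-- An ordinal is presented by a well-ordered type of that order type.  Its
-- elements stand for the smaller ordinals.
record WellOrder (ℓ : Level) : Set (suc ℓ) where
  infix 4 _<_ _≤_
  field
    Carrier            : Set ℓ
    _<_                : Rel Carrier ℓ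
    isStrictTotalOrder : IsStrictTotalOrder _≡_ _<_
    <-irrelevant       : Irrelevant _<_
    <-wellFounded      : WellFounded _<_

  _≤_ : Rel Carrier ℓ
  x ≤ y = x < y ⊎ x ≡ y

ω : WellOrder 0ℓ
ω = record
  { Carrier            = ℕ
  ; _<_                = ℕ._<_
  ; isStrictTotalOrder = ℕ.<-isStrictTotalOrder
  ; <-irrelevant       = ℕ.<-irrelevant
  ; <-wellFounded      = ℕ.<-wellFounded
  }

finite : ℕ → WellOrder 0ℓ
finite n = record
  { Carrier            = Fin n
  ; _<_                = Fin._<_
  ; isStrictTotalOrder = Fin.<-isStrictTotalOrder
  ; <-irrelevant       = Fin.<-irrelevant
  ; <-wellFounded      = Fin.<-wellFounded
  }

infix 8 _↓_

-- The element a of W, regarded as an ordinal in its own right.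
_↓_ : (W : WellOrder ℓ) → WellOrder.Carrier W → WellOrder ℓ
_↓_ {ℓ} W a = record
  { Carrier            = Below
  ; _<_                = _<_ on proj₁
  ; isStrictTotalOrder = record
    { isStrictPartialOrder = record
      { isEquivalence = ≡.isEquivalence
      ; irrefl        = irrefl ∘ cong proj₁
      ; trans         = trans
      ; <-resp-≈      = (λ { refl p → p }) , (λ { refl p → p })
      }
    ; compare = cmp
    }
  ; <-irrelevant       = <-irrelevant
  ; <-wellFounded      = On.wellFounded proj₁ <-wellFounded
  }
  where
  open WellOrder W
  open IsStrictTotalOrder isStrictTotalOrder using (compare; irrefl; trans)

  Below : Set ℓ
  Below = Σ[ x ∈ Carrier ] x < a

  proj₁-injective : {x y : Below} → proj₁ x ≡ proj₁ y → x ≡ y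
  proj₁-injective {x , p} {.x , q} refl = cong (x ,_) (<-irrelevant p q)

  cmp : Trichotomous {A = Below} _≡_ (_<_ on proj₁)
  cmp x y with compare (proj₁ x) (proj₁ y)
  ... | tri< l n g = tri< l (n ∘ cong proj₁) g
  ... | tri≈ l e g = tri≈ l (proj₁-injective e) g
  ... | tri> l n g = tri> l (n ∘ cong proj₁) g

infix 4 _≺_

_≺_ : WellOrder ℓ → WellOrder ℓ′ → Set (ℓ ⊔ ℓ′)
V ≺ W = ∃[ a ] let module V = WellOrder V; module Wa = WellOrder (W ↓ a) in
  Σ[ f ∈ (V.Carrier → Wa.Carrier) ] IsOrderIsomorphism _≡_ _≡_ V._≤_ Wa._≤_ f

CofinalMap : WellOrder ℓ → WellOrder ℓ′ → Set (ℓ ⊔ ℓ′)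
CofinalMap V W = let module V = WellOrder V; module W = WellOrder W in
  Σ[ f ∈ (V.Carrier → W.Carrier) ] (∀ x → ∃[ i ] x W.≤ f i)

-- cf(W) = V: V is the least ordinal with a cofinal map into W.
IsCofinality : WellOrder ℓ → WellOrder ℓ′ → Set (ℓ ⊔ ℓ′)
IsCofinality W V = CofinalMap V W × (∀ a → ¬ CofinalMap (V ↓ a) W)

IsCardinal : WellOrder ℓ → Set ℓ
IsCardinal W = ∀ a → ¬ (WellOrder.Carrier W ↣ WellOrder.Carrier (W ↓ a))

record IsRegularUncountable (W : WellOrder ℓ) : Set ℓ where
  field
    isCardinal  : IsCardinal W
    regular     : IsCofinality W W
    uncountable : ¬ (WellOrder.Carrier W ↣ ℕ)

-- |X| < κ.  For a cardinal κ this says that X injects into some ordinal below κ.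
FewerThan : {a b : Level} → WellOrder ℓ → Setoid a b → Set (ℓ ⊔ a ⊔ b)
FewerThan κ X = ∃[ a ] Injection X (≡.setoid (WellOrder.Carrier (κ ↓ a)))

module Combinatorics {ℓ : Level} (Λ : WellOrder ℓ) where
  open WellOrder Λ
  open AddSupremum _<_ using (_<⁺_)

  -- The ordinals ≤ Λ: [ α ] for α below Λ, and ⊤⁺ for Λ itself.
  Ordinal⁺ : Set ℓ
  Ordinal⁺ = Carrier ⁺

  Subset : Set (suc ℓ)
  Subset = Pred Carrier ℓ

  below : Carrier → Subset
  below α x = x < α

  IsSup : Subset → Carrier → Set ℓ
  IsSup A β = (∀ {x} → x ∈ A → x ≤ β) × (∀ γ → (∀ {x} → x ∈ A → x ≤ γ) → β ≤ γ)

  -- The first component is β < sup { α + 1 ∣ α ∈ A }.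
  acc : Subset → Subset
  acc A β = (∃[ α ] α ∈ A × β ≤ α) × IsSup (A ∩ below β) β

  -- Non-strict unboundedness makes { β } unbounded in β + 1.  As sup ∅ = 0,
  -- closure has to exclude γ = 0, hence the nonemptiness condition.
  record IsClub (δ : Ordinal⁺) (C : Subset) : Set ℓ where
    field
      bounded   : ∀ {x} → x ∈ C → [ x ] <⁺ δ
      unbounded : ∀ x → [ x ] <⁺ δ → ∃[ y ] y ∈ C × x ≤ y
      closed    : ∀ γ → [ γ ] <⁺ δ → Satisfiable (C ∩ below γ) → IsSup (C ∩ below γ) γ → γ ∈ C

  IsStationary : Ordinal⁺ → Subset → Set (suc ℓ)
  IsStationary δ S = ∀ C → IsClub δ C → Satisfiable (S ∩ C)

  -- A set of subsets; extensionality of sets is imposed as closure under _≐_.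
  record Collection : Set (suc (suc ℓ)) where
    field
      Member   : Pred Subset (suc ℓ)
      respects : Member Respects _≐_

    setoid : Setoid (suc ℓ) ℓ
    setoid = On.setoid {B = Σ Subset Member} (≐-setoid Carrier ℓ) proj₁

  open Collection public using (Member)

  IsSuccessor : Carrier → Carrier → Set ℓ
  IsSuccessor β α = β < α × (∀ γ → β < γ → α ≤ γ)

  record IsCoherent (η : WellOrder ℓ′) (𝒞 : Carrier → Collection) : Set (suc ℓ ⊔ ℓ′) where
    field
      nonempty  : ∀ α → Satisfiable (Member (𝒞 α))
      width     : ∀ α → FewerThan η (Collection.setoid (𝒞 α))
      clubs     : ∀ α {C} → C ∈ Member (𝒞 α) → IsClub [ α ] C
      successor : ∀ {β α} → IsSuccessor β α → Member (𝒞 α) ≐ (_≐ ｛ β ｝)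
      coherent  : ∀ β {C} → C ∈ Member (𝒞 β) → ∀ {α} → α ∈ acc C → (C ∩ below α) ∈ Member (𝒞 α)

  IsThread : (Carrier → Collection) → Subset → Set (suc ℓ)
  IsThread 𝒞 D = IsClub ⊤⁺ D × (∀ {α} → α ∈ acc D → (D ∩ below α) ∈ Member (𝒞 α))

  -- □(Λ, <η)
  □< : WellOrder ℓ′ → Set (suc (suc ℓ) ⊔ ℓ′)
  □< η = ∃[ 𝒞 ] IsCoherent η 𝒞 × ¬ (∃[ D ] IsThread 𝒞 D)

  UncountableCofinality : Carrier → Set (suc ℓ)
  UncountableCofinality α = Σ[ κ ∈ WellOrder ℓ ] IsCofinality (Λ ↓ α) κ × ω ≺ κ

  ReflectsAt : Subset → Carrier → Set (suc ℓ)
  ReflectsAt S α = UncountableCofinality α × IsStationary [ α ] (S ∩ below α)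

  -- Refl(<κ, S)
  Refl< : WellOrder ℓ′ → Subset → Set (suc (suc ℓ) ⊔ ℓ′)
  Refl< κ S = ∀ (𝒯 : Collection) → FewerThan κ (Collection.setoid 𝒯) →
    (∀ {T} → T ∈ Member 𝒯 → T ⊆ S × IsStationary ⊤⁺ T) →
    ∃[ α ] (∀ {T} → T ∈ Member 𝒯 → ReflectsAt T α)

  -- Refl(n, S) for finite n, whose cardinal successor is n + 1.
  Refl : ℕ → Subset → Set (suc (suc ℓ))
  Refl n = Refl< (finite (ℕ.suc n))

{-# OPTIONS --safe #-}

-- The sets C ∩ α, for C in some 𝒞 β, form a tree.  Fix α.  By Fodor's lemma there is a finite set
-- H of nodes at level α such that, for stationarily many β ∈ S, every C ∈ 𝒞 β passes through H.
-- If for stationarily many other β ∈ S every C ∈ 𝒞 β avoids H, these two sets do not reflect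
-- simultaneously: for C ∈ 𝒞 δ, limit points β of C in either set have C ∩ β ∈ 𝒞 β, and C ∩ α
-- would both lie in H and not lie in H.
--
-- Otherwise, at each α some finite H "hits" 𝒞 β for almost all β ∈ S.  The minimal size of a
-- hitting set increases with α, so it is eventually constant.  At each such level only finitely
-- many nodes belong to a hitting set of minimal size, and these nodes are closed under restriction.
-- For stationarily many β some C ∈ 𝒞 β runs through such nodes only.  A node is thick if
-- stationarily many of these C extend it.  Thick nodes form a tree with finite levels in which
-- every node extends to all higher levels; by Fodor's lemma, from some level on each node has only
-- one extension.  The union of such a branch is a thread.
module Submission where

open import Defs
open import Axiom.ExcludedMiddle using (ExcludedMiddle)
open import Data.Empty using (⊥-elim)
open import Data.Fin.Base using (zero; suc)
open import Data.List.Base using (List; []; _∷_; _++_; length; concatMap)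
open import Data.List.Membership.Propositional using (find; lose)
open import Data.List.Membership.Propositional.Properties using (∈-∃++)
open import Data.List.Properties using (length-++-sucʳ)
open import Data.List.Relation.Unary.All as All using (All; []; _∷_)
import Data.List.Relation.Unary.All.Properties as All
open import Data.List.Relation.Unary.Any as Any using (Any; here; there)
import Data.List.Relation.Unary.Any.Properties as Any
open import Data.Nat.Base as ℕ using (ℕ; zero; suc)
import Data.Nat.Properties as ℕ
open import Data.Product.Base using (Σ; Σ-syntax; ∃; _×_; _,_; proj₁; proj₂; ∃-syntax)
open import Data.Sum.Base using (_⊎_; inj₁; inj₂; [_,_]′)
open import Function.Base using (_∘_; _|>_; case_of_)
open import Function.Bundles using (Injection; mk↣)
import Induction.WellFounded as WF
open import Level using (Level; Lift; lift; _⊔_) renaming (suc to lsuc)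
import Relation.Binary.Construct.Add.Supremum.Strict as AddSupremum
open import Relation.Binary.Core using (Rel)
open import Relation.Binary.Definitions using (tri<; tri≈; tri>)
open import Relation.Binary.Morphism.Structures using (IsOrderIsomorphism)
open import Relation.Binary.PropositionalEquality.Core using (_≡_; _≢_; refl; sym; trans; cong; subst)
open import Relation.Binary.Structures using (IsStrictTotalOrder)
open import Relation.Nullary.Construct.Add.Supremum using (⊤⁺; [_])
import Relation.Nullary.Decidable.Core as Dec
open import Relation.Nullary.Decidable.Core using (True; toWitness; fromWitness; yes; no; decidable-stable)
open import Relation.Nullary.Negation.Core using (¬_; contradiction)
open import Relation.Unary using (Pred; _∈_; _⊆_; _≐_; _∩_; Satisfiable)
open import Relation.Unary.Properties using (≐-refl; ≐-sym; ≐-trans)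

private
  variable
    a b q r : Level

-- Classical logic and resizing

module Classical (em : ∀ {a} → ExcludedMiddle a) where

  opaque
    by-contradiction : {P : Set a} → ¬ ¬ P → P
    by-contradiction = decidable-stable em

  ¬∀⇒∃¬ : {A : Set a} {B : Pred A b} → ¬ (∀ x → B x) → ∃[ x ] ¬ B x
  ¬∀⇒∃¬ ¬∀ = by-contradiction λ ¬∃ → ¬∀ λ x → by-contradiction λ ¬Bx → ¬∃ (x , ¬Bx)

  -- The truth value of P, placed in an arbitrary universe.
  record Resize (ℓ : Level) (P : Set a) : Set ℓ where
    constructor resized
    field
      witness : True (em {P = P})

  resize : ∀ {ℓ} {P : Set a} → P → Resize ℓ P
  resize p = resized (fromWitness p)

  unresize : ∀ {ℓ} {P : Set a} → Resize ℓ P → P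
  unresize (resized w) = toWitness w

-- Suprema, limit points and cofinality in a well-order

module OrderTheory (em : ∀ {a} → ExcludedMiddle a) {ℓ : Level} (Λ : WellOrder ℓ) where
  open Classical em
  open WellOrder Λ
  open Combinatorics Λ
  open AddSupremum _<_ public using (_<⁺_; [_]; [_]<⊤⁺)
  open IsStrictTotalOrder isStrictTotalOrder public using (compare; irrefl) renaming (trans to <-trans)

  <-irr : ∀ {x} → ¬ x < x
  <-irr = irrefl refl

  ≤-<-trans : ∀ {x y z} → x ≤ y → y < z → x < z
  ≤-<-trans (inj₁ p) q = <-trans p q
  ≤-<-trans (inj₂ refl) q = q

  <-≤-trans : ∀ {x y z} → x < y → y ≤ z → x < z
  <-≤-trans p (inj₁ q) = <-trans p q
  <-≤-trans p (inj₂ refl) = p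

  ≤-trans : ∀ {x y z} → x ≤ y → y ≤ z → x ≤ z
  ≤-trans p (inj₁ q) = inj₁ (≤-<-trans p q)
  ≤-trans p (inj₂ refl) = p

  ≮⇒≥ : ∀ {x y} → ¬ x < y → y ≤ x
  ≮⇒≥ {x} {y} x≮y with compare x y
  ... | tri< x<y _ _ = contradiction x<y x≮y
  ... | tri≈ _ x≡y _ = inj₂ (sym x≡y)
  ... | tri> _ _ y<x = inj₁ y<x

  ≰⇒> : ∀ {x y} → ¬ x ≤ y → y < x
  ≰⇒> {x} {y} x≰y = by-contradiction (x≰y ∘ ≮⇒≥)

  ≤-total : ∀ x y → x ≤ y ⊎ y ≤ x
  ≤-total x y with compare x y
  ... | tri< x<y _ _ = inj₁ (inj₁ x<y)
  ... | tri≈ _ x≡y _ = inj₁ (inj₂ x≡y)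
  ... | tri> _ _ y<x = inj₂ (inj₁ y<x)

  max : ∀ x y → ∃[ z ] (x ≤ z × y ≤ z) × (z ≡ x ⊎ z ≡ y)
  max x y with ≤-total x y
  ... | inj₁ x≤y = y , (x≤y , inj₂ refl) , inj₂ refl
  ... | inj₂ y≤x = x , (inj₂ refl , y≤x) , inj₁ refl

  max-< : ∀ {x y u} → x < u → y < u → ∃[ z ] (x ≤ z × y ≤ z) × z < u
  max-< {x} {y} x<u y<u with max x y
  ... | z , z≥ , inj₁ refl = z , z≥ , x<u
  ... | z , z≥ , inj₂ refl = z , z≥ , y<u

  least : {P : Pred Carrier a} → ∃ P → ∃[ x ] P x × (∀ {y} → P y → x ≤ y)
  least {P = P} (x , Px) = go x (<-wellFounded x) Px
    where
    go : ∀ x → WF.Acc _<_ x → P x → ∃[ x ] P x × (∀ {y} → P y → x ≤ y)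
    go x (WF.acc rec) Px with em {P = ∃[ y ] y < x × P y}
    ... | yes (y , y<x , Py) = go y (rec y<x) Py
    ... | no ¬smaller = x , Px , λ Py → ≮⇒≥ λ y<x → ¬smaller (_ , y<x , Py)

  <⁺-down : ∀ {x y δ} → x ≤ y → [ y ] <⁺ δ → [ x ] <⁺ δ
  <⁺-down x≤y [ y<δ ] = [ ≤-<-trans x≤y y<δ ]
  <⁺-down x≤y [ _ ]<⊤⁺ = [ _ ]<⊤⁺

  -- Once the head of the list fails at some `α`, it fails at all later levels, so the witnesses
  -- there lie in the tail; `anti` brings them down again.
  uniform-witness : {X : Set q} {P : Carrier → X → Set r} {β : Carrier} →
    (∀ {α α′ x} → α ≤ α′ → P α′ x → P α x) → ∃[ y ] y < β → (xs : List X) →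
    (∀ {α} → α < β → Any (P α) xs) → Any (λ x → ∀ {α} → α < β → P α x) xs
  uniform-witness anti (y , y<β) [] witness = case witness y<β of λ ()
  uniform-witness {P = P} {β} anti pos (x ∷ xs) witness with em {P = ∃[ α ] α < β × ¬ P α x}
  ... | no none = here λ α<β → by-contradiction λ ¬P → none (_ , α<β , ¬P)
  ... | yes (α , α<β , ¬Pαx) = there (uniform-witness anti pos xs λ {α′} α′<β →
    let γ , (α≤γ , α′≤γ) , γ<β = max-< α<β α′<β
    in case witness γ<β of λ
      { (here Pγx) → contradiction (anti α≤γ Pγx) ¬Pαx
      ; (there Pγxs) → Any.map (anti α′≤γ) Pγxs
      })

  uniform-bound : {X : Set q} {P : Carrier → X → Set r} {β : Carrier} →
    (∀ {α α′ x} → α ≤ α′ → P α x → P α′ x) → ∃[ y ] y < β →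
    (∀ x → ∃[ α ] α < β × P α x) → (xs : List X) → ∃[ α ] α < β × All (P α) xs
  uniform-bound mono (y , y<β) bound [] = y , y<β , []
  uniform-bound mono pos bound (x ∷ xs) =
    let α , α<β , Px = bound x
        α′ , α′<β , Pxs = uniform-bound mono pos bound xs
        γ , (α≤γ , α′≤γ) , γ<β = max-< α<β α′<β
    in γ , γ<β , mono α≤γ Px ∷ All.map (mono α′≤γ) Pxs

  IsLimit : Pred Carrier ℓ
  IsLimit γ = ∀ {y} → y < γ → ∃[ z ] y < z × z < γ

  IsSup-intro : ∀ {A : Subset} {γ} →
    (∀ {y} → y < γ → ∃[ z ] (A z × z < γ) × y < z) → IsSup (A ∩ below γ) γ
  IsSup-intro above = (inj₁ ∘ proj₂) , λ γ′ ub → ≮⇒≥ λ γ′<γ →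
    let z , z∈ , γ′<z = above γ′<γ in <-irr (<-≤-trans γ′<z (ub z∈))

  IsSup-elim : ∀ {A : Subset} {γ} → IsSup A γ → ∀ {y} → y < γ → ∃[ z ] A z × y < z
  IsSup-elim (_ , lub) {y} y<γ = by-contradiction λ none →
    <-irr (<-≤-trans y<γ (lub y λ z∈ → ≮⇒≥ λ y<z → none (_ , z∈ , y<z)))

  IsSup-resp-≐ : ∀ {A B : Subset} {γ} → A ≐ B → IsSup A γ → IsSup B γ
  IsSup-resp-≐ (A⊆B , B⊆A) (ub , lub) = (ub ∘ B⊆A) , λ γ′ ub′ → lub γ′ (ub′ ∘ A⊆B)

  -- For nonzero `δ` this is uncountable cofinality in terms of sequences; the strictness of the
  -- bound excludes successors.
  ωBounded : Ordinal⁺ → Set ℓ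
  ωBounded δ = ∀ (f : ℕ → Carrier) → (∀ n → [ f n ] <⁺ δ) → ∃[ b ] [ b ] <⁺ δ × (∀ n → f n < b)

  -- The point `γ` is the least strict upper bound of the iterates of `step`, and `u`, `v` are
  -- consecutive iterates. Limit points of clubs and points of diagonal intersections are both found
  -- in this way.
  ω-limit : ∀ {δ} → ωBounded δ → {Q : Rel Carrier q} →
    (∀ x → [ x ] <⁺ δ → ∃[ y ] [ y ] <⁺ δ × x < y × Q x y) →
    ∀ x → [ x ] <⁺ δ → ∃[ γ ] [ γ ] <⁺ δ × x < γ ×
      (∀ {y} → y < γ → ∃[ u ] ∃[ v ] y ≤ u × u < v × v < γ × Q u v)
  ω-limit {δ = δ} ωb {Q} step x x<δ =
    let b , b<δ , f<b = ωb f f<δ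
        γ , f<γ , γ-least = least {P = λ γ → ∀ n → f n < γ} (b , f<b)
    in γ , <⁺-down (γ-least f<b) b<δ , f<γ 0 , λ {y} y<γ →
      let n , fn≮y = ¬∀⇒∃¬ λ f<y → <-irr (<-≤-trans y<γ (γ-least f<y))
          _ , _ , fn<fsn , Qn = step (f n) (f<δ n)
      in f n , f (suc n) , ≮⇒≥ fn≮y , fn<fsn , f<γ (suc n) , Qn
    where
    seq : ℕ → Σ[ x ∈ Carrier ] [ x ] <⁺ δ
    seq zero = x , x<δ
    seq (suc n) = let x , x<δ = seq n; y , y<δ , _ = step x x<δ in y , y<δ

    f : ℕ → Carrier
    f = proj₁ ∘ seq

    f<δ : ∀ n → [ f n ] <⁺ δ
    f<δ = proj₂ ∘ seq

  -- For a club `C` in a limit `δ` this is `acc C` without 0, the supremum of the empty set.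
  limitPoints : Ordinal⁺ → Subset → Subset
  limitPoints δ C γ = [ γ ] <⁺ δ × Satisfiable (C ∩ below γ) × IsSup (C ∩ below γ) γ

  limitPoints⊆ : ∀ {δ C} → IsClub δ C → limitPoints δ C ⊆ C
  limitPoints⊆ club (γ<δ , sat , sup) = IsClub.closed club _ γ<δ sat sup

  limitPoints-isClub : ∀ {δ C} → ωBounded δ → IsClub δ C → IsClub δ (limitPoints δ C)
  limitPoints-isClub {δ} {C} ωb club = record
    { bounded = proj₁
    ; unbounded = λ x x<δ →
        let γ , γ<δ , x<γ , cofinal = ω-limit ωb {Q = λ _ y → C y} step x x<δ
            _ , v , _ , _ , v<γ , Cv = cofinal x<γ
        in γ , (γ<δ , (v , Cv , v<γ) , IsSup-intro λ y<γ →
             let _ , v , y≤u , u<v , v<γ , Cv = cofinal y<γ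
             in v , (Cv , v<γ) , ≤-<-trans y≤u u<v)
           , inj₁ x<γ
    ; closed = λ γ γ<δ (z , (_ , (w , Cw , w<z) , _) , z<γ) sup →
        γ<δ , (w , Cw , <-trans w<z z<γ) , IsSup-intro λ y<γ →
          let z , ((_ , _ , sup-z) , z<γ) , y<z = IsSup-elim sup y<γ
              w , (Cw , w<z) , y<w = IsSup-elim sup-z y<z
          in w , (Cw , <-trans w<z z<γ) , y<w
    }
    where
    open IsClub club

    step : ∀ x → [ x ] <⁺ δ → ∃[ y ] [ y ] <⁺ δ × x < y × C y
    step x x<δ =
      -- The strict bound of a constant sequence is a larger element that is still below `δ`.
      let b , b<δ , x<b = ωb (λ _ → x) (λ _ → x<δ)
          y , Cy , b≤y = unbounded b b<δ
      in y , bounded Cy , <-≤-trans (x<b 0) b≤y , Cy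

  -- The isomorphism turns a sequence into a map from `κ ↓ a`, which cannot be cofinal because `κ`
  -- is the least ordinal with a cofinal map.
  uncountableCofinality⇒ωBounded : ∀ {δ} → UncountableCofinality δ → ωBounded [ δ ]
  uncountableCofinality⇒ωBounded {δ} (κ , (_ , minimal) , a , g , iso) f f<δ =
    let (b , b<δ) , b≰ = ¬∀⇒∃¬ λ cofinal → minimal a (f′ , cofinal)
    in b , [ b<δ ] , λ n → ≰⇒> λ b≤fn → b≰ (g n , lift-≤ (subst (λ k → b ≤ f k) (sym (inverse n)) b≤fn))
    where
    open IsOrderIsomorphism iso using (surjective; injective)

    inv : WellOrder.Carrier (κ ↓ a) → ℕ
    inv = proj₁ ∘ surjective

    inverse : ∀ n → inv (g n) ≡ n
    inverse n = injective (proj₂ (surjective (g n)) refl)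

    unwrap : ∀ {x} → [ x ] <⁺ [ δ ] → x < δ
    unwrap [ x<δ ] = x<δ

    f′ : WellOrder.Carrier (κ ↓ a) → WellOrder.Carrier (Λ ↓ δ)
    f′ i = f (inv i) , unwrap (f<δ (inv i))

    lift-≤ : ∀ {b b<δ i} → b ≤ f (inv i) → WellOrder._≤_ (Λ ↓ δ) (b , b<δ) (f′ i)
    lift-≤ (inj₁ b<) = inj₁ b<
    lift-≤ (inj₂ refl) = inj₂ (cong (_ ,_) (<-irrelevant _ _))

  Refl-pair : ∀ {S T₁ T₂ : Subset} → Refl 2 S →
    T₁ ⊆ S × IsStationary ⊤⁺ T₁ → T₂ ⊆ S × IsStationary ⊤⁺ T₂ →
    ∃[ α ] ReflectsAt T₁ α × ReflectsAt T₂ α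
  Refl-pair {S} {T₁} {T₂} reflects T₁-ok T₂-ok =
    let α , at-α = reflects 𝒯 few λ (lift which) →
          [ (λ T≐T₁ → transport T≐T₁ T₁-ok) , (λ T≐T₂ → transport T≐T₂ T₂-ok) ]′ which
    in α , at-α (lift (inj₁ ≐-refl)) , at-α (lift (inj₂ ≐-refl))
    where
    𝒯 : Collection
    𝒯 = record
      { Member = λ T → Lift (lsuc ℓ) (T ≐ T₁ ⊎ T ≐ T₂)
      ; respects = λ T≐T′ (lift which) →
          lift ([ inj₁ ∘ ≐-trans (≐-sym T≐T′) , inj₂ ∘ ≐-trans (≐-sym T≐T′) ]′ which)
      }

    transport : ∀ {T T′ : Subset} → T ≐ T′ → T′ ⊆ S × IsStationary ⊤⁺ T′ → T ⊆ S × IsStationary ⊤⁺ T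
    transport (T⊆T′ , T′⊆T) (T′⊆S , stat) =
      (T′⊆S ∘ T⊆T′) , λ C club → let x , T′x , Cx = stat C club in x , T′⊆T T′x , Cx

    -- `Refl 2` asks for fewer than 3 sets, hence for an injection into two colours. Testing against
    -- `T₁` alone gives one, also when `T₁ ≐ T₂`.
    colour : Subset → WellOrder.Carrier (finite 3 ↓ suc (suc zero))
    colour T with em {P = T ≐ T₁}
    ... | yes _ = zero , ℕ.s≤s ℕ.z≤n
    ... | no _ = suc zero , ℕ.s≤s (ℕ.s≤s ℕ.z≤n)

    colour-cong : ∀ {T T′} → T ≐ T′ → colour T ≡ colour T′
    colour-cong {T} {T′} T≐T′ with em {P = T ≐ T₁} | em {P = T′ ≐ T₁}
    ... | yes _ | yes _ = refl
    ... | no _ | no _ = refl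
    ... | yes T≐T₁ | no T′≐̸T₁ = contradiction (≐-trans (≐-sym T≐T′) T≐T₁) T′≐̸T₁
    ... | no T≐̸T₁ | yes T′≐T₁ = contradiction (≐-trans T≐T′ T′≐T₁) T≐̸T₁

    colour-injective : ∀ {T T′} → T ∈ Member 𝒯 → T′ ∈ Member 𝒯 → colour T ≡ colour T′ → T ≐ T′
    colour-injective {T} {T′} (lift T∈) (lift T′∈) eq with em {P = T ≐ T₁} | em {P = T′ ≐ T₁}
    ... | yes T≐T₁ | yes T′≐T₁ = ≐-trans T≐T₁ (≐-sym T′≐T₁)
    ... | no T≐̸T₁ | no T′≐̸T₁ = ≐-trans (second T∈ T≐̸T₁) (≐-sym (second T′∈ T′≐̸T₁))
      where
      second : ∀ {T} → T ≐ T₁ ⊎ T ≐ T₂ → ¬ T ≐ T₁ → T ≐ T₂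
      second = [ (λ T≐T₁ T≐̸T₁ → contradiction T≐T₁ T≐̸T₁) , (λ T≐T₂ _ → T≐T₂) ]′
    colour-injective _ _ () | yes _ | no _
    colour-injective _ _ () | no _ | yes _

    few : FewerThan (finite 3) (Collection.setoid 𝒯)
    few = suc (suc zero) , record
      { to = colour ∘ proj₁
      ; cong = colour-cong
      ; injective = λ {(_ , T∈)} {(_ , T′∈)} → colour-injective T∈ T′∈
      }

-- Clubs and stationary sets of a regular uncountable cardinal

module Stationarity (em : ∀ {a} → ExcludedMiddle a) {ℓ : Level} (Λ : WellOrder ℓ)
  (regular : IsRegularUncountable Λ) where
  open Classical em
  open OrderTheory em Λ
  open WellOrder Λ
  open Combinatorics Λ

  image-bounded : ∀ {α} (f : WellOrder.Carrier (Λ ↓ α) → Carrier) → ∃[ b ] (∀ i → f i < b)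
  image-bounded {α} f =
    let b , b≰ = ¬∀⇒∃¬ λ cofinal → proj₂ (IsRegularUncountable.regular regular) α (f , cofinal)
    in b , λ i → ≰⇒> λ b≤ → b≰ (i , b≤)

  opaque
    inhabited : Carrier
    inhabited = by-contradiction λ empty → IsRegularUncountable.uncountable regular
      (mk↣ {to = ⊥-elim ∘ empty} λ {x} → ⊥-elim (empty x))

  -- Below a maximum `x` there is no `y`, since regularity would give a strict bound for the map on
  -- `Λ ↓ x` with constant value `x`. So `x` would be the only element, and `Λ` would inject into ℕ.
  no-max : ∀ x → ∃[ y ] x < y
  no-max x = by-contradiction λ is-max → IsRegularUncountable.uncountable regular
    (mk↣ {to = λ _ → 0} λ {y} {z} _ → trans (top is-max y) (sym (top is-max z)))
    where
    top : ¬ (∃[ y ] x < y) → ∀ y → y ≡ x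
    top is-max y with compare y x
    ... | tri≈ _ y≡x _ = y≡x
    ... | tri> _ _ x<y = contradiction (_ , x<y) is-max
    ... | tri< y<x _ _ =
      let b , x<b = image-bounded {x} (λ _ → x) in contradiction (b , x<b (y , y<x)) is-max

  successor : ∀ x → ∃[ y ] x < y × (∀ {z} → x < z → y ≤ z)
  successor x = least (no-max x)

  -- The finite ordinals as an initial segment of `Λ`; the trivial predicate `x ≡ x` has 0 as its
  -- least element.
  ι : ℕ → Carrier
  ι zero = proj₁ (least {P = λ x → x ≡ x} (inhabited , refl))
  ι (suc n) = proj₁ (successor (ι n))

  ι-step : ∀ n → ι n < ι (suc n)
  ι-step n = proj₁ (proj₂ (successor (ι n)))

  ι-mono : ∀ {m n} → m ℕ.≤′ n → ι m ≤ ι n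
  ι-mono ℕ.≤′-refl = inj₂ refl
  ι-mono {n = suc n} (ℕ.≤′-step m≤n) = ≤-trans (ι-mono m≤n) (inj₁ (ι-step n))

  ι-mono-< : ∀ {m n} → m ℕ.< n → ι m < ι n
  ι-mono-< {m} m<n = <-≤-trans (ι-step m) (ι-mono (ℕ.≤⇒≤′ m<n))

  ι-injective : ∀ {m n} → ι m ≡ ι n → m ≡ n
  ι-injective {m} {n} eq with ℕ.<-cmp m n
  ... | tri< m<n _ _ = contradiction (ι-mono-< m<n) (irrefl eq)
  ... | tri≈ _ m≡n _ = m≡n
  ... | tri> _ _ n<m = contradiction (ι-mono-< n<m) (irrefl (sym eq))

  ι-initial : ∀ {x} n → x ≤ ι n → ∃[ k ] x ≡ ι k
  ι-initial n (inj₂ x≡) = n , x≡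
  ι-initial zero (inj₁ x<) =
    contradiction (<-≤-trans x< (proj₂ (proj₂ (least (inhabited , refl))) refl)) <-irr
  ι-initial {x} (suc n) (inj₁ x<) = ι-initial n (≮⇒≥ λ ιn<x →
    <-irr (<-≤-trans x< (proj₂ (proj₂ (successor (ι n))) ιn<x)))

  opaque
    ι-bounded : ∃[ b ] (∀ n → ι n < b)
    ι-bounded = by-contradiction λ unbounded →
      let index : ∀ x → ∃[ k ] x ≡ ι k
          index x = let n , ιn≮x = ¬∀⇒∃¬ λ ι<x → unbounded (x , ι<x) in ι-initial n (≮⇒≥ ιn≮x)
      in IsRegularUncountable.uncountable regular (mk↣ {to = proj₁ ∘ index} λ {x} {y} eq →
           trans (proj₂ (index x)) (trans (cong ι eq) (sym (proj₂ (index y)))))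

  opaque
    -- The range of `ι` lies below some `b`, so a sequence becomes a map on `Λ ↓ b`, which
    -- regularity bounds.
    ω-bounded : ωBounded ⊤⁺
    ω-bounded f _ =
      let b , ι<b = ι-bounded
          c , f<c = image-bounded {b} (λ (x , _) → f (index x))
      in c , [ c ]<⊤⁺ , λ n → subst (λ k → f k < c) (index-ι n) (f<c (ι n , ι<b n))
      where
      index : Carrier → ℕ
      index x with em {P = ∃[ n ] x ≡ ι n}
      ... | yes (n , _) = n
      -- A default: only the values on the range of `ι` matter.
      ... | no _ = 0

      index-ι : ∀ n → index (ι n) ≡ n
      index-ι n with em {P = ∃[ k ] ι n ≡ ι k}
      ... | yes (k , eq) = sym (ι-injective eq)
      ... | no none = contradiction (n , refl) none

  diagonal-isClub : (E : Carrier → Subset) → (∀ γ → IsClub ⊤⁺ (E γ)) →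
    IsClub ⊤⁺ (λ β → ∀ γ → γ < β → E γ β)
  diagonal-isClub E club = record
    { bounded = λ _ → [ _ ]<⊤⁺
    ; unbounded = λ x _ →
        let β , _ , x<β , cofinal = ω-limit ω-bounded {Q = Q} step x [ x ]<⊤⁺
        in β , (λ γ γ<β →
             -- Past `γ`, each later step of the iteration puts a new element of `E γ` below `β`, so
             -- `β` is a limit of `E γ`.
             let beyond : ∀ {y} → y < β → ∃[ z ] (E γ z × z < β) × y < z
                 beyond y<β =
                   let _ , v , γ≤u , u<v , v<β , _ = cofinal γ<β
                       w , (y≤w , v≤w) , w<β = max-< y<β v<β
                       u′ , v′ , w≤u′ , _ , v′<β , Q′ = cofinal w<β
                       z , Ez , u′<z , z<v′ =
                         Q′ γ (<-≤-trans (≤-<-trans γ≤u u<v) (≤-trans v≤w w≤u′))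
                   in z , (Ez , <-trans z<v′ v′<β) , ≤-<-trans (≤-trans y≤w w≤u′) u′<z
                 z , z∈ , _ = beyond γ<β
             in IsClub.closed (club γ) β [ β ]<⊤⁺ (z , z∈) (IsSup-intro beyond))
           , inj₁ x<β
    ; closed = λ β β<⊤ _ sup γ γ<β →
        let beyond : ∀ {y} → y < β → ∃[ z ] (E γ z × z < β) × y < z
            beyond y<β =
              let w , (y≤w , γ≤w) , w<β = max-< y<β γ<β
                  z , (z∈Δ , z<β) , w<z = IsSup-elim sup w<β
              in z , (z∈Δ γ (≤-<-trans γ≤w w<z) , z<β) , ≤-<-trans y≤w w<z
            z , z∈ , _ = beyond γ<β
        in IsClub.closed (club γ) β β<⊤ (z , z∈) (IsSup-intro beyond)
    }
    where
    Q : Rel Carrier ℓ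
    Q x y = ∀ γ → γ < x → ∃[ z ] E γ z × x < z × z < y

    step : ∀ x → [ x ] <⁺ ⊤⁺ → ∃[ y ] [ y ] <⁺ ⊤⁺ × x < y × Q x y
    step x _ =
      let next : ∀ γ → ∃[ z ] E γ z × proj₁ (no-max x) ≤ z
          next γ = IsClub.unbounded (club γ) (proj₁ (no-max x)) [ _ ]<⊤⁺
          -- Regularity bounds the choices, one for each `γ < x`.
          b , next<b = image-bounded {x} (proj₁ ∘ next ∘ proj₁)
          y , (b≤y , x⁺≤y) , _ = max b (proj₁ (no-max x))
      in y , [ y ]<⊤⁺ , <-≤-trans (proj₂ (no-max x)) x⁺≤y , λ γ γ<x →
           let z , Ez , x⁺≤z = next γ
           in z , Ez , <-≤-trans (proj₂ (no-max x)) x⁺≤z , <-≤-trans (next<b (γ , γ<x)) b≤y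

  -- IsStationary ⊤⁺, extended to predicates of any level.
  record Stationary (A : Pred Carrier a) : Set (a ⊔ lsuc ℓ) where
    constructor stationary
    field
      intersects : ∀ C → IsClub ⊤⁺ C → Satisfiable (A ∩ C)

  open Stationary public

  stationary-mono : {A : Pred Carrier a} {B : Pred Carrier b} → A ⊆ B → Stationary A → Stationary B
  stationary-mono A⊆B stat = stationary λ C club →
    let x , Ax , Cx = intersects stat C club in x , A⊆B Ax , Cx

  stationary-above : {A : Pred Carrier a} → Stationary A → ∀ α → Stationary (λ β → A β × α < β)
  stationary-above stat α = stationary λ C club →
    let β , Aβ , Cβ , α<β = intersects stat (λ β → C β × α < β) record
          { bounded = λ _ → [ _ ]<⊤⁺
          ; unbounded = λ x _ →
              let y , (x≤y , α≤y) , _ = max x α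
                  z , y<z = no-max y
                  w , Cw , z≤w = IsClub.unbounded club z [ z ]<⊤⁺
                  y<w = <-≤-trans y<z z≤w
              in w , (Cw , ≤-<-trans α≤y y<w) , inj₁ (≤-<-trans x≤y y<w)
          ; closed = λ γ γ<⊤ (z , (Cz , α<z) , z<γ) sup →
              IsClub.closed club γ γ<⊤ (z , Cz , z<γ)
                (IsSup-intro λ y<γ → let z , ((Cz , _) , z<γ) , y<z = IsSup-elim sup y<γ
                                     in z , (Cz , z<γ) , y<z)
              , <-trans α<z z<γ
          }
    in β , (Aβ , α<β) , Cβ

  stationary-satisfiable : {A : Pred Carrier a} → Stationary A → Satisfiable A
  stationary-satisfiable stat = let β , Aβ , _ = intersects stat _ whole in β , Aβ
    where
    whole : IsClub ⊤⁺ (λ β → β ≡ β)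
    whole = record
      { bounded = λ _ → [ _ ]<⊤⁺
      ; unbounded = λ x _ → x , refl , inj₂ refl
      ; closed = λ _ _ _ _ → refl
      }

  opaque
    -- Otherwise the set of each value `γ` is disjoint from some club, and a `β ∈ A` in the diagonal
    -- intersection of these clubs has no value left.
    fodor : {A : Pred Carrier a} (R : Carrier → Carrier → Set r) → Stationary A →
      (∀ {β} → A β → ∃[ γ ] γ < β × R β γ) → ∃[ γ ] Stationary (λ β → A β × R β γ)
    fodor {A = A} R stat regressive = by-contradiction λ none →
      let avoid : ∀ γ → ∃[ C ] IsClub ⊤⁺ C × ¬ Satisfiable ((λ β → A β × R β γ) ∩ C)
          avoid γ = by-contradiction λ ¬avoid → none (γ , stationary λ C club →
            by-contradiction λ disjoint → ¬avoid (C , club , disjoint))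
          β , Aβ , Δβ = intersects stat _ (diagonal-isClub (proj₁ ∘ avoid) (proj₁ ∘ proj₂ ∘ avoid))
          γ , γ<β , Rβγ = regressive Aβ
      in proj₂ (proj₂ (avoid γ)) (β , (Aβ , Rβγ) , Δβ γ γ<β)

  opaque
    -- Above all finite ordinals, the colour `n` read as `ι n` is a regressive value, so Fodor's
    -- lemma applies.
    ω-pigeonhole : {A : Pred Carrier a} (R : Carrier → ℕ → Set r) → Stationary A →
      (∀ {β} → A β → ∃[ n ] R β n) → ∃[ n ] Stationary (λ β → A β × R β n)
    ω-pigeonhole R stat colour =
      let b , ι<b = ι-bounded
          γ , stat-γ = fodor (λ β γ → ∃[ n ] γ ≡ ι n × R β n) (stationary-above stat b) λ (Aβ , b<β) →
            let n , Rβn = colour Aβ in ι n , <-trans (ι<b n) b<β , n , refl , Rβn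
          _ , _ , k , γ≡ιk , _ = stationary-satisfiable stat-γ
      in k , stationary-mono (λ ((Aβ , _) , n , γ≡ιn , Rβn) →
           Aβ , subst (R _) (ι-injective (trans (sym γ≡ιn) γ≡ιk)) Rβn) stat-γ

  opaque
    ⊎-pigeonhole : ∀ {a b r} {A : Pred Carrier a} {P : Pred Carrier b} {Q : Pred Carrier r} → Stationary A →
      (∀ {β} → A β → P β ⊎ Q β) →
      Stationary (λ β → A β × P β) ⊎ Stationary (λ β → A β × Q β)
    ⊎-pigeonhole {b = b} {r} {A} {P} {Q} stat split with em {P = Stationary (λ β → A β × P β)}
    ... | yes stat-P = inj₁ stat-P
    ... | no ¬stat-P = inj₂ (case ω-pigeonhole R stat (λ Aβ → colour (split Aβ)) of λ
      { (zero , stat-0) → contradiction (stationary-mono (λ (Aβ , r) → Aβ , proj₁ r refl) stat-0) ¬stat-P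
      ; (suc n , stat-n) → stationary-mono (λ (Aβ , r) → Aβ , proj₂ r (λ ())) stat-n
      })
      where
      -- Colour 0 codes `P`, every other colour codes `Q`.
      R : Carrier → ℕ → Set (b ⊔ r)
      R β n = (n ≡ 0 → P β) × (n ≢ 0 → Q β)

      colour : ∀ {β} → P β ⊎ Q β → ∃ (R β)
      colour (inj₁ p) = 0 , (λ _ → p) , λ 0≢0 → contradiction refl 0≢0
      colour (inj₂ q) = 1 , (λ ()) , λ _ → q

  opaque
    list-pigeonhole : {X : Set q} {A : Pred Carrier a} (R : Carrier → X → Set r) (xs : List X) →
      Stationary A → (∀ {β} → A β → Any (R β) xs) → ∃[ x ] Stationary (λ β → A β × R β x)
    list-pigeonhole R [] stat colour = case colour (proj₂ (stationary-satisfiable stat)) of λ ()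
    list-pigeonhole R (x ∷ xs) stat colour with ⊎-pigeonhole stat (Any.toSum ∘ colour)
    ... | inj₁ stat-x = x , stat-x
    ... | inj₂ stat-xs =
      let y , stat-y = list-pigeonhole R xs stat-xs proj₂
      in y , stationary-mono (λ ((Aβ , _) , Rβy) → Aβ , Rβy) stat-y

  limits-stationary : ∀ α → Stationary (λ γ → α < γ × IsLimit γ)
  limits-stationary α = stationary λ C club →
    let α⁺ , α<α⁺ = no-max α
        γ , lim@(_ , _ , sup) , α⁺≤γ = IsClub.unbounded (limitPoints-isClub ω-bounded club) α⁺ [ α⁺ ]<⊤⁺
    in γ
     , (<-≤-trans α<α⁺ α⁺≤γ , λ y<γ → let z , (_ , z<γ) , y<z = IsSup-elim sup y<γ in z , y<z , z<γ)
     , limitPoints⊆ club lim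

-- The tree of initial segments of the square sequence

module Square (em : ∀ {a} → ExcludedMiddle a) {ℓ : Level} (Λ : WellOrder ℓ)
  (regular : IsRegularUncountable Λ) (𝒞 : WellOrder.Carrier Λ → Combinatorics.Collection Λ)
  (isCoherent : Combinatorics.IsCoherent Λ ω 𝒞) where
  open Classical em
  open OrderTheory em Λ
  open Stationarity em Λ regular
  open WellOrder Λ
  open Combinatorics Λ
  open IsCoherent isCoherent hiding (successor)

  infix 4 _≈[_]_

  -- A node at level α of the tree is represented by any subset, up to agreement below α;
  -- restriction to a lower level then leaves the representative unchanged.
  record _≈[_]_ (C : Subset) (α : Carrier) (D : Subset) : Set ℓ where
    constructor agree
    field
      ≈⇒ : ∀ {y} → y < α → C y → D y
      ≈⇐ : ∀ {y} → y < α → D y → C y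

  open _≈[_]_

  ≈-sym : ∀ {α C D} → C ≈[ α ] D → D ≈[ α ] C
  ≈-sym (agree to from) = agree from to

  ≈-trans : ∀ {α C D E} → C ≈[ α ] D → D ≈[ α ] E → C ≈[ α ] E
  ≈-trans (agree to from) (agree to′ from′) =
    agree (λ y<α → to′ y<α ∘ to y<α) (λ y<α → from y<α ∘ from′ y<α)

  ≈-anti : ∀ {α α′ C D} → α ≤ α′ → C ≈[ α′ ] D → C ≈[ α ] D
  ≈-anti α≤α′ (agree to from) =
    agree (λ y<α → to (<-≤-trans y<α α≤α′)) (λ y<α → from (<-≤-trans y<α α≤α′))

  ≐⇒≈ : ∀ {α C D} → C ≐ D → C ≈[ α ] D
  ≐⇒≈ (C⊆D , D⊆C) = agree (λ _ → C⊆D) (λ _ → D⊆C)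

  ∩-below-≈ : ∀ {α β C} → α ≤ β → (C ∩ below β) ≈[ α ] C
  ∩-below-≈ α≤β = agree (λ _ → proj₁) (λ y<α Cy → Cy , <-≤-trans y<α α≤β)

  ≈⇒∩-below-≐ : ∀ {α C D} → C ≈[ α ] D → (C ∩ below α) ≐ (D ∩ below α)
  ≈⇒∩-below-≐ (agree to from) =
    (λ (Cy , y<α) → to y<α Cy , y<α) , (λ (Dy , y<α) → from y<α Dy , y<α)

  Meets : Carrier → List Subset → Subset → Set (lsuc ℓ)
  Meets α H C = Any (C ≈[ α ]_) H

  Meets-resp-≈ : ∀ {α H C D} → C ≈[ α ] D → Meets α H C → Meets α H D
  Meets-resp-≈ C≈D = Any.map (≈-trans (≈-sym C≈D))

  member-unbounded : ∀ {β C} → C ∈ Member (𝒞 β) → ∀ {α} → α < β → ∃[ y ] C y × α ≤ y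
  member-unbounded C∈ α<β = IsClub.unbounded (clubs _ C∈) _ [ α<β ]

  member-< : ∀ {β C y} → C ∈ Member (𝒞 β) → C y → y < β
  member-< C∈ Cy with IsClub.bounded (clubs _ C∈) Cy
  ... | [ y<β ] = y<β

  index : ∀ β {C} → C ∈ Member (𝒞 β) → ℕ
  index β {C} C∈ = proj₁ (Injection.to (proj₂ (width β)) (C , C∈))

  index-bound : ∀ β {C} (C∈ : C ∈ Member (𝒞 β)) → index β C∈ ℕ.< proj₁ (width β)
  index-bound β {C} C∈ = proj₂ (Injection.to (proj₂ (width β)) (C , C∈))

  index-injective : ∀ β {C D} (C∈ : C ∈ Member (𝒞 β)) (D∈ : D ∈ Member (𝒞 β)) →
    index β C∈ ≡ index β D∈ → C ≐ D
  index-injective β {C} {D} C∈ D∈ eq =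
    Injection.injective (proj₂ (width β)) {C , C∈} {D , D∈} (pair-≡ eq)
    where
    pair-≡ : ∀ {n} {x y : Σ ℕ (ℕ._< n)} → proj₁ x ≡ proj₁ y → x ≡ y
    pair-≡ refl = cong (_ ,_) (ℕ.<-irrelevant _ _)

  enumeration : ∀ α → ∃[ xs ] (∀ {C} → C ∈ Member (𝒞 α) → Any (C ≐_) xs)
  enumeration α = let xs , complete = go (proj₁ (width α)) in xs , λ C∈ → complete C∈ (index-bound α C∈)
    where
    go : ∀ n → ∃[ xs ] (∀ {C} (C∈ : C ∈ Member (𝒞 α)) → index α C∈ ℕ.< n → Any (C ≐_) xs)
    go zero = [] , λ _ ()
    go (suc n) with go n | em {P = ∃[ C ] Σ[ C∈ ∈ C ∈ Member (𝒞 α) ] index α C∈ ≡ n}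
    ... | xs , complete | yes (D , D∈ , eq) = D ∷ xs , λ C∈ lt →
      case ℕ.m≤n⇒m<n∨m≡n (ℕ.s≤s⁻¹ lt) of λ
        { (inj₁ lt′) → there (complete C∈ lt′)
        ; (inj₂ eq′) → here (index-injective α C∈ D∈ (trans eq′ (sym eq)))
        }
    ... | xs , complete | no none = xs , λ C∈ lt →
      case ℕ.m≤n⇒m<n∨m≡n (ℕ.s≤s⁻¹ lt) of λ
        { (inj₁ lt′) → complete C∈ lt′
        ; (inj₂ eq′) → contradiction (_ , C∈ , eq′) none
        }

  -- Either α is a limit point of C, and C ∩ α lies in the finite collection 𝒞 α, or C ∩ α is
  -- contained in γ + 1 for some γ < α, which Fodor's lemma makes independent of β.
  opaque
    node-pigeonhole : ∀ α (R : Carrier → Subset → Set r) → (∀ {β C} → R β C → C ∈ Member (𝒞 β)) →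
      Stationary (λ β → ∃[ C ] R β C) → ∃[ x ] Stationary (λ β → ∃[ C ] R β C × C ≈[ α ] x)
    node-pigeonhole α = go α (<-wellFounded α)
      where
      go : ∀ {r} α → WF.Acc _<_ α → (R : Carrier → Subset → Set r) →
        (∀ {β C} → R β C → C ∈ Member (𝒞 β)) →
        Stationary (λ β → ∃[ C ] R β C) → ∃[ x ] Stationary (λ β → ∃[ C ] R β C × C ≈[ α ] x)
      -- For `β` above `α`, a bound `γ < α` is regressive in `β`, and `C` has an element from `α`
      -- on, as membership of `α` in `acc C` demands.
      go {r} α (WF.acc rec) R R⊆𝒞 stat with ⊎-pigeonhole {P = Limit} {Q = Bounded} (stationary-above stat α) split
        where
        Limit Bounded : Pred Carrier (lsuc ℓ ⊔ r)
        Limit β = ∃[ C ] R β C × IsSup (C ∩ below α) α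
        Bounded β = ∃[ γ ] γ < β × γ < α × (∃[ C ] R β C × (∀ {y} → C y → y < α → y ≤ γ))

        split : ∀ {β} → (∃[ C ] R β C) × α < β → Limit β ⊎ Bounded β
        split {β} ((C , RβC) , α<β) with em {P = IsSup (C ∩ below α) α}
        ... | yes sup = inj₁ (C , RβC , sup)
        ... | no ¬sup =
          let γ , γ<α , ub = by-contradiction
                {P = ∃[ γ ] γ < α × (∀ {y} → C y → y < α → y ≤ γ)} λ none → ¬sup (IsSup-intro λ {y} y<α →
                by-contradiction λ none′ → none (y , y<α , λ Cz z<α → ≮⇒≥ λ y<z →
                  none′ (_ , (Cz , z<α) , y<z)))
          in inj₂ (γ , <-trans γ<α α<β , γ<α , C , RβC , ub)
      ... | inj₁ stat-limit =
        let xs , complete = enumeration α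
            x , stat-x = list-pigeonhole (λ β x → ∃[ C ] R β C × C ≈[ α ] x) xs stat-limit
              λ ((_ , α<β) , C , RβC , sup) →
                Any.map (λ C∩α≐x → C , RβC , ≈-trans (≈-sym (∩-below-≈ (inj₂ refl))) (≐⇒≈ C∩α≐x))
                  (complete (coherent _ (R⊆𝒞 RβC) (member-unbounded (R⊆𝒞 RβC) α<β , sup)))
        in x , stationary-mono proj₂ stat-x
      ... | inj₂ stat-bounded =
        let R′ : Carrier → Carrier → Subset → Set _
            R′ γ β C = R β C × (∀ {y} → C y → y < α → y ≤ γ)
            γ , stat-γ = fodor (λ β γ → γ < α × ∃ (R′ γ β)) stat-bounded proj₂
            _ , _ , γ<α , _ = stationary-satisfiable stat-γ
            x , stat-x = go γ (rec γ<α) (R′ γ) (R⊆𝒞 ∘ proj₁) (stationary-mono (proj₂ ∘ proj₂) stat-γ)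
            -- As `C ∩ α` is contained in `γ + 1`, its node at level `α` is determined by its node
            -- at level `γ` and by whether `γ` is in `C`.
            with-γ : Subset
            with-γ y = (y < γ × x y) ⊎ y ≡ γ
            without-γ : Subset
            without-γ y = y < γ × x y
        in list-pigeonhole (λ β x → ∃[ C ] R β C × C ≈[ α ] x) (with-γ ∷ without-γ ∷ []) stat-x
             (λ {β} (C , (RβC , ub) , C≈x) → case em {P = C γ} of λ
               { (yes Cγ) → here (C , RβC , agree
                   (λ y<α Cy → case ub Cy y<α of λ
                     { (inj₁ y<γ) → inj₁ (y<γ , ≈⇒ C≈x y<γ Cy)
                     ; (inj₂ y≡γ) → inj₂ y≡γ
                     })
                   λ { _ (inj₁ (y<γ , xy)) → ≈⇐ C≈x y<γ xy ; _ (inj₂ refl) → Cγ })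
               ; (no ¬Cγ) → there (here (C , RβC , agree
                   (λ y<α Cy → case ub Cy y<α of λ
                     { (inj₁ y<γ) → y<γ , ≈⇒ C≈x y<γ Cy
                     ; (inj₂ refl) → contradiction Cy ¬Cγ
                     })
                   λ _ (y<γ , xy) → ≈⇐ C≈x y<γ xy))
               })
           |> λ (z , stat-z) → z , stationary-mono proj₂ stat-z

  opaque
    -- First the bound `n` on the indices is fixed. Then, one index at a time, the stationary set
    -- shrinks until the members with that index share a node, or none has that index.
    cover : ∀ α {A : Pred Carrier a} → Stationary A →
      ∃[ H ] Stationary (λ β → A β × (∀ {C} → C ∈ Member (𝒞 β) → Meets α H C))
    cover α {A} stat =
      let n , stat-n = ω-pigeonhole (λ β n → proj₁ (width β) ≡ n) stat λ _ → _ , refl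
          H , stat-H = go stat-n n
      in H , stationary-mono (λ { {β} ((Aβ , eq) , covered) →
           Aβ , λ C∈ → covered C∈ (subst (index β C∈ ℕ.<_) eq (index-bound β C∈)) }) stat-H
      where
      CoveredUpTo : ℕ → List Subset → Pred Carrier (lsuc ℓ)
      CoveredUpTo n H β = ∀ {C} (C∈ : C ∈ Member (𝒞 β)) → index β C∈ ℕ.< n → Meets α H C

      HasIndex : ℕ → Carrier → Subset → Set (lsuc ℓ)
      HasIndex n β C = Σ[ C∈ ∈ C ∈ Member (𝒞 β) ] index β C∈ ≡ n

      covered-suc : ∀ {n H β} → CoveredUpTo n H β → (∀ {C} → HasIndex n β C → Meets α H C) →
        CoveredUpTo (suc n) H β
      covered-suc covered covered-n C∈ lt with ℕ.m≤n⇒m<n∨m≡n (ℕ.s≤s⁻¹ lt)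
      ... | inj₁ lt′ = covered C∈ lt′
      ... | inj₂ eq = covered-n (C∈ , eq)

      go : ∀ {a} {A : Pred Carrier a} → Stationary A → ∀ n →
        ∃[ H ] Stationary (λ β → A β × CoveredUpTo n H β)
      go stat zero = [] , stationary-mono (λ Aβ → Aβ , λ _ ()) stat
      go {A = A} stat (suc n) with go stat n
      ... | H , stat-H with ⊎-pigeonhole {P = λ β → ∃ (HasIndex n β)} stat-H (λ _ → Dec.toSum em)
      ... | inj₁ stat-yes =
        let x , stat-x = node-pigeonhole α (λ β C → HasIndex n β C × A β × CoveredUpTo n H β)
              (proj₁ ∘ proj₁) (stationary-mono (λ (covered , C , has) → C , has , covered) stat-yes)
        in x ∷ H , stationary-mono (λ { {β} (D , ((D∈ , eq) , Aβ , covered) , D≈x) →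
             Aβ , covered-suc (λ C∈ lt → there (covered C∈ lt)) λ (C∈ , eq′) →
               here (≈-trans (≐⇒≈ (index-injective β C∈ D∈ (trans eq′ (sym eq)))) D≈x) }) stat-x
      ... | inj₂ stat-no = H , stationary-mono (λ ((Aβ , covered) , none) →
             Aβ , covered-suc covered λ has → contradiction (_ , has) none) stat-no

  -- Since `δ` has uncountable cofinality, the limit points of `C` form a club in `δ`, which `T`
  -- meets; coherence applies at the common point.
  reflection-restricts : ∀ {T δ C} → ReflectsAt T δ → C ∈ Member (𝒞 δ) →
    ∃[ β ] T β × (C ∩ below β) ∈ Member (𝒞 β)
  reflection-restricts (cf>ω , stat) C∈ =
    let club = clubs _ C∈
        β , (Tβ , _) , lim@(_ , _ , sup) = stat _
          (limitPoints-isClub (uncountableCofinality⇒ωBounded cf>ω) club)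
    in β , Tβ , coherent _ C∈ ((β , limitPoints⊆ club lim , inj₂ refl) , sup)

  separated-nonreflecting : ∀ {α H T₁ T₂} →
    (∀ {β} → T₁ β → α < β × (∀ {C} → C ∈ Member (𝒞 β) → Meets α H C)) →
    (∀ {β} → T₂ β → α < β × (∀ {C} → C ∈ Member (𝒞 β) → ¬ Meets α H C)) →
    ¬ (∃[ δ ] ReflectsAt T₁ δ × ReflectsAt T₂ δ)
  separated-nonreflecting meet miss (δ , refl₁ , refl₂) =
    let C , C∈ = nonempty δ
        β₁ , T₁β₁ , C∩β₁∈ = reflection-restricts refl₁ C∈
        β₂ , T₂β₂ , C∩β₂∈ = reflection-restricts refl₂ C∈
        α<β₁ , meets = meet T₁β₁
        α<β₂ , misses = miss T₂β₂
    in misses C∩β₂∈ (Meets-resp-≈ (≈-trans (∩-below-≈ (inj₁ α<β₁)) (≈-sym (∩-below-≈ (inj₁ α<β₂))))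
         (meets C∩β₁∈))

  -- Construction of a thread when no set of nodes separates

  module Branch {S : Subset} (S-stationary : Stationary S)
    (inseparable : ∀ α H →
      Stationary (λ β → S β × α < β × (∀ {C} → C ∈ Member (𝒞 β) → Meets α H C)) →
      ¬ Stationary (λ β → S β × α < β × (∀ {C} → C ∈ Member (𝒞 β) → ¬ Meets α H C))) where

    Misses : Carrier → List Subset → Pred Carrier (lsuc ℓ)
    Misses α H β = S β × (∀ {C} → C ∈ Member (𝒞 β) → ¬ Meets α H C)

    -- For almost all β ∈ S, some C ∈ 𝒞 β meets H.
    Hitting : Carrier → List Subset → Set (lsuc ℓ)
    Hitting α H = ¬ Stationary (Misses α H)

    hitting-anti : ∀ {α α′ H} → α ≤ α′ → Hitting α′ H → Hitting α H
    hitting-anti α≤α′ hit stat = hit (stationary-mono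
      (λ (Sβ , misses) → Sβ , λ C∈ → misses C∈ ∘ Any.map (≈-anti α≤α′)) stat)

    hitting-mono : ∀ {α H H′} → (∀ {C} → Meets α H C → Meets α H′ C) → Hitting α H → Hitting α H′
    hitting-mono H⊑H′ hit stat = hit (stationary-mono
      (λ (Sβ , misses) → Sβ , λ C∈ → misses C∈ ∘ H⊑H′) stat)

    opaque
      hitting-meets : ∀ {α H} {B : Pred Carrier b} → Hitting α H → B ⊆ S → Stationary B →
        ∃[ β ] B β × (∃[ C ] C ∈ Member (𝒞 β) × Meets α H C)
      hitting-meets hit B⊆S stat = by-contradiction λ none → hit (stationary-mono
        (λ Bβ → B⊆S Bβ , λ C∈ meets → none (_ , Bβ , _ , C∈ , meets)) stat)

    opaque
      -- The set from `cover` is met on a stationary set, so `inseparable` forbids that it is missed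
      -- on another.
      hitting-exists : ∀ α → ∃[ H ] Hitting α H
      hitting-exists α =
        let H , stat = cover α (stationary-above S-stationary α)
        in H , λ stat′ → inseparable α H
             (stationary-mono (λ ((Sβ , α<β) , meets) → Sβ , α<β , meets) stat)
             (stationary-mono (λ ((Sβ , misses) , α<β) → Sβ , α<β , misses) (stationary-above stat′ α))

    -- Hitting sets of minimal size

    HitBy : ℕ → Pred Carrier (lsuc ℓ)
    HitBy n α = ∃[ H ] length H ℕ.≤ n × Hitting α H

    opaque
      -- If each size `n` failed at some level, a bound `b` of these levels would have a hitting set
      -- of some size `n`, which restricts to the level where `n` fails.
      hitBy-uniform : ∃[ n ] (∀ α → HitBy n α)
      hitBy-uniform = by-contradiction λ none →
        let fails : ∀ n → ∃[ α ] ¬ HitBy n α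
            fails n = ¬∀⇒∃¬ λ all → none (n , all)
            b , _ , fails<b = ω-bounded (proj₁ ∘ fails) (λ _ → [ _ ]<⊤⁺)
            H , hit = hitting-exists b
            n = length H
        in proj₂ (fails n) (H , ℕ.≤-refl , hitting-anti (inj₁ (fails<b n)) hit)

    not-hitBy-zero : ∀ {α} → ¬ HitBy 0 α
    not-hitBy-zero ([] , _ , hit) = hit (stationary-mono (λ Sβ → Sβ , λ _ ()) S-stationary)

    opaque
      -- The least size that works at all levels is positive, as the empty list misses every
      -- `β ∈ S`; hence it can be written `suc m`.
      hitBy-threshold : ∃[ m ] (∀ α → HitBy (suc m) α) × (∃[ α ] ¬ HitBy m α)
      hitBy-threshold = let n , all = hitBy-uniform in go n all
        where
        go : ∀ n → (∀ α → HitBy n α) → ∃[ m ] (∀ α → HitBy (suc m) α) × (∃[ α ] ¬ HitBy m α)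
        go zero all = ⊥-elim (not-hitBy-zero (all inhabited))
        go (suc n) all with em {P = ∀ α → HitBy n α}
        ... | yes all′ = go n all′
        ... | no ¬all = n , all , ¬∀⇒∃¬ ¬all

    m : ℕ
    m = proj₁ hitBy-threshold

    α₀ : Carrier
    α₀ = proj₁ (proj₂ (proj₂ hitBy-threshold))

    -- Restriction to `α₀` preserves size, so from `α₀` on the minimal size is exactly `suc m`.
    short-not-hitting : ∀ {α H} → α₀ ≤ α → length H ℕ.≤ m → ¬ Hitting α H
    short-not-hitting α₀≤α short hit =
      proj₂ (proj₂ (proj₂ hitBy-threshold)) (_ , short , hitting-anti α₀≤α hit)

    -- Sets of size ≤ m + 1 hitting a family of finite sets, when no set of size ≤ m does:
    -- a partial choice H misses some member of the family, which bounds the next choice.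
    hitting-extensions : ∀ {α} → α₀ ≤ α → ∀ j H → length H ℕ.+ j ℕ.≤ suc m →
      ∃[ L ] (∀ G → length G ℕ.≤ j → Hitting α (H ++ G) → All (Meets α L) G)
    hitting-extensions α₀≤α zero H _ = [] , λ { [] _ _ → [] }
    hitting-extensions {α} α₀≤α (suc j) H size =
      (F ++ concatMap (λ x → proj₁ (ih x)) F) , bound
      where
      sum-suc : length H ℕ.+ suc j ≡ suc (length H ℕ.+ j)
      sum-suc = ℕ.+-suc (length H) j

      family : ∃[ F ] Stationary (λ β → Misses α H β × (∀ {C} → C ∈ Member (𝒞 β) → Meets α F C))
      -- The size condition leaves `H` at most `m` nodes, too few to hit.
      family = cover α (by-contradiction (short-not-hitting α₀≤α
        (ℕ.≤-trans (ℕ.m≤m+n (length H) j) (ℕ.s≤s⁻¹ (subst (ℕ._≤ suc m) sum-suc size)))))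

      F : List Subset
      F = proj₁ family

      ih : ∀ x → ∃[ L ] (∀ G → length G ℕ.≤ j → Hitting α ((x ∷ H) ++ G) → All (Meets α L) G)
      ih x = hitting-extensions α₀≤α j (x ∷ H) (subst (ℕ._≤ suc m) sum-suc size)

      bound : ∀ G → length G ℕ.≤ suc j → Hitting α (H ++ G) →
        All (Meets α (F ++ concatMap (λ x → proj₁ (ih x)) F)) G
      bound G short hit with hitting-meets hit (proj₁ ∘ proj₁) (proj₂ family)
      ... | β , ((_ , misses) , meetsF) , C , C∈ , meets with Any.++⁻ H meets
      ... | inj₁ meetsH = contradiction meetsH (misses C∈)
      ... | inj₂ meetsG with find meetsG | find (meetsF C∈)
      ... | x′ , x′∈G , C≈x′ | x , x∈F , C≈x with ∈-∃++ x′∈G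
      ... | G₁ , G₂ , refl =
        -- Both `x′` in `G` and `x` in `F` agree with `C` below `α`. Hence `x` can replace `x′` and
        -- move into `H`, which leaves `G₁ ++ G₂` to the induction hypothesis.
        let rest = proj₂ (ih x) (G₁ ++ G₂)
              (ℕ.s≤s⁻¹ (subst (ℕ._≤ suc j) (length-++-sucʳ G₁ x′ G₂) short))
              (hitting-mono swap hit)
            rest₁ , rest₂ = All.++⁻ G₁ (All.map embed rest)
        in All.++⁺ rest₁ (Any.++⁺ˡ (lose x∈F (≈-trans (≈-sym C≈x′) C≈x)) ∷ rest₂)
        where
        embed : ∀ {y} → Meets α (proj₁ (ih x)) y → Meets α (F ++ concatMap (λ x → proj₁ (ih x)) F) y
        embed = Any.++⁺ʳ F ∘ Any.concatMap⁺ (λ x → proj₁ (ih x)) ∘ lose x∈F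

        swap : ∀ {D} → Meets α (H ++ G₁ ++ x′ ∷ G₂) D → Meets α ((x ∷ H) ++ G₁ ++ G₂) D
        swap D-meets with Any.++⁻ H D-meets
        ... | inj₁ D-H = there (Any.++⁺ˡ D-H)
        ... | inj₂ D-G with Any.++⁻ G₁ D-G
        ...   | inj₁ D-G₁ = there (Any.++⁺ʳ H (Any.++⁺ˡ D-G₁))
        ...   | inj₂ (here D≈x′) = here (≈-trans D≈x′ (≈-trans (≈-sym C≈x′) C≈x))
        ...   | inj₂ (there D-G₂) = there (Any.++⁺ʳ H (Any.++⁺ʳ G₁ D-G₂))

    Node : Carrier → Subset → Set (lsuc ℓ)
    Node α x = ∃[ H ] length H ℕ.≤ suc m × Hitting α H × Meets α H x

    node-anti : ∀ {α α′ x} → α ≤ α′ → Node α′ x → Node α x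
    node-anti α≤α′ (H , short , hit , meets) =
      H , short , hitting-anti α≤α′ hit , Any.map (≈-anti α≤α′) meets

    node-resp-≈ : ∀ {α x y} → x ≈[ α ] y → Node α x → Node α y
    node-resp-≈ x≈y (H , short , hit , meets) = H , short , hit , Meets-resp-≈ x≈y meets

    opaque
      nodes-finite : ∀ {α} → α₀ ≤ α → ∃[ L ] (∀ {x} → Node α x → Meets α L x)
      nodes-finite α₀≤α =
        let L , bound = hitting-extensions α₀≤α (suc m) [] ℕ.≤-refl
        in L , λ (H , short , hit , meets) →
          let y , y∈H , x≈y = find meets
          in Meets-resp-≈ (≈-sym x≈y) (All.lookup (bound H short hit) y∈H)

    Path : Carrier → Subset → Set (lsuc ℓ)
    Path β C = C ∈ Member (𝒞 β) × (∀ {α} → α < β → Node α C)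

    opaque
      -- If stationarily many `β` had a level without nodes from `𝒞 β`, Fodor's lemma would fix that
      -- level, against a hitting set there. Otherwise all levels below `β` have nodes, and as `𝒞 β`
      -- is finite, one `C` serves them all.
      paths-stationary : Stationary (λ β → ∃[ C ] Path β C)
      paths-stationary with ⊎-pigeonhole {P = AllLevels} {Q = MissedLevel} S-stationary (λ _ → split)
        where
        AllLevels MissedLevel : Pred Carrier (lsuc ℓ)
        AllLevels β = ∀ {α} → α < β → ∃[ C ] C ∈ Member (𝒞 β) × Node α C
        MissedLevel β = ∃[ α ] α < β × (∀ {C} → C ∈ Member (𝒞 β) → ¬ Node α C)

        split : ∀ {β} → AllLevels β ⊎ MissedLevel β
        split {β} with em {P = MissedLevel β}
        ... | yes missed = inj₂ missed
        ... | no none = inj₁ λ α<β → by-contradiction λ none′ →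
          none (_ , α<β , λ C∈ node → none′ (_ , C∈ , node))
      ... | inj₂ stat-bad =
        let α , stat-α = fodor (λ β α → ∀ {C} → C ∈ Member (𝒞 β) → ¬ Node α C) stat-bad proj₂
            H , short , hit = proj₁ (proj₂ hitBy-threshold) α
            _ , (_ , no-node) , C , C∈ , meets = hitting-meets hit (proj₁ ∘ proj₁) stat-α
        in contradiction (H , short , hit , meets) (no-node C∈)
      -- Here `0<β` is `inhabited < β`: some level below `β` is needed to read off that `C` belongs
      -- to `𝒞 β`.
      ... | inj₁ stat-good = stationary-mono (λ { {β} ((_ , nodes) , 0<β) →
          let xs , complete = enumeration β
              C , _ , path = find (uniform-witness {P = λ α C → C ∈ Member (𝒞 β) × Node α C}
                (λ α≤α′ (C∈ , node) → C∈ , node-anti α≤α′ node) (_ , 0<β) xs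
                λ α<β → let D , D∈ , node = nodes α<β
                        in Any.map (λ D≐x → Collection.respects (𝒞 β) D≐x D∈ , node-resp-≈ (≐⇒≈ D≐x) node)
                             (complete D∈))
          in C , proj₁ (path 0<β) , proj₂ ∘ path }) (stationary-above stat-good inhabited)

    -- Thick nodes and their extensions

    Thick : Carrier → Subset → Set (lsuc ℓ)
    Thick α x = Stationary (λ β → ∃[ C ] Path β C × C ≈[ α ] x)

    thick-anti : ∀ {α α′ x} → α ≤ α′ → Thick α′ x → Thick α x
    thick-anti α≤α′ = stationary-mono λ (C , path , C≈x) → C , path , ≈-anti α≤α′ C≈x

    thick⇒path : ∀ {α x} → Thick α x → ∃[ β ] α < β × (∃[ C ] Path β C × C ≈[ α ] x)
    thick⇒path {α} thick =
      let β , p , α<β = stationary-satisfiable (stationary-above thick α) in β , α<β , p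

    thick⇒node : ∀ {α x} → Thick α x → Node α x
    thick⇒node thick =
      let β , α<β , C , (_ , nodes) , C≈x = thick⇒path thick in node-resp-≈ C≈x (nodes α<β)

    opaque
      -- Among the stationarily many paths through `x`, stationarily many share a node at level
      -- `α′`.
      thick-extends : ∀ {α α′ x} → α ≤ α′ → Thick α x → ∃[ z ] Thick α′ z × z ≈[ α ] x
      thick-extends {α} {α′} {x} α≤α′ thick =
        let z , stat = node-pigeonhole α′ (λ β C → Path β C × C ≈[ α ] x) (proj₁ ∘ proj₁) thick
            _ , C , (_ , C≈x) , C≈z = stationary-satisfiable stat
        in z , stationary-mono (λ (C , (path , _) , C≈z) → C , path , C≈z) stat
         , ≈-trans (≈-sym (≈-anti α≤α′ C≈z)) C≈x

    Separates : Carrier → Carrier → Set (lsuc ℓ)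
    Separates g γ = ∀ {x y} → Thick γ x → Thick γ y → x ≈[ g ] y → x ≈[ γ ] y

    -- Finitely many distinct subsets of a limit γ already differ below some g < γ.
    limit-separates : ∀ {γ} → α₀ < γ → IsLimit γ → ∃[ g ] g < γ × Separates g γ
    limit-separates {γ} α₀<γ lim =
      let L , complete = nodes-finite (inj₁ α₀<γ)
          g , g<γ , separated = uniform-bound
            {P = λ g x → All (λ y → x ≈[ g ] y → x ≈[ γ ] y) L}
            (λ g≤g′ → All.map λ sep x≈y → sep (≈-anti g≤g′ x≈y)) (α₀ , α₀<γ)
            (λ x → uniform-bound {P = λ g y → x ≈[ g ] y → x ≈[ γ ] y}
              (λ g≤g′ sep x≈y → sep (≈-anti g≤g′ x≈y)) (α₀ , α₀<γ) (separate x) L) L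
      in g , g<γ , λ thick-x thick-y x≈y →
        let x′ , x′∈ , x≈x′ = find (complete (thick⇒node thick-x))
            y′ , y′∈ , y≈y′ = find (complete (thick⇒node thick-y))
            g≤γ = inj₁ g<γ
            x′≈y′ = All.lookup (All.lookup separated x′∈) y′∈
              (≈-trans (≈-sym (≈-anti g≤γ x≈x′)) (≈-trans x≈y (≈-anti g≤γ y≈y′)))
        in ≈-trans x≈x′ (≈-trans x′≈y′ (≈-sym y≈y′))
      where
      separate : ∀ x y → ∃[ g ] g < γ × (x ≈[ g ] y → x ≈[ γ ] y)
      separate x y = by-contradiction λ none →
        let agreement : ∀ {t} (t<γ : t < γ) → x ≈[ proj₁ (lim t<γ) ] y
            agreement t<γ = by-contradiction λ differ → none
              (_ , proj₂ (proj₂ (lim t<γ)) , λ x≈y → contradiction x≈y differ)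
        -- If no level below `γ` tells `x` and `y` apart, they agree below the limit `γ`, and then
        -- any level, such as `α₀`, will do.
        in none (α₀ , α₀<γ , λ _ → agree
             (λ t<γ → ≈⇒ (agreement t<γ) (proj₁ (proj₂ (lim t<γ))))
             (λ t<γ → ≈⇐ (agreement t<γ) (proj₁ (proj₂ (lim t<γ)))))

    opaque
      -- Fodor's lemma makes the separating level the same for stationarily many limits `γ`. Thick
      -- nodes at `α` are extended to such a `γ` above `α`, compared there and restricted back.
      separation : ∃[ g ] (∀ {α x y} → g ≤ α → Thick α x → Thick α y → x ≈[ g ] y → x ≈[ α ] y)
      separation =
        let g , stat = fodor (λ γ g → Separates g γ) (limits-stationary α₀)
              (λ (α₀<γ , lim) → limit-separates α₀<γ lim)
        in g , λ {α} g≤α thick-x thick-y x≈y →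
          let γ , (_ , separates) , α<γ = stationary-satisfiable (stationary-above stat α)
              x′ , thick-x′ , x′≈x = thick-extends (inj₁ α<γ) thick-x
              y′ , thick-y′ , y′≈y = thick-extends (inj₁ α<γ) thick-y
              x′≈y′ = separates thick-x′ thick-y′
                (≈-trans (≈-anti g≤α x′≈x) (≈-trans x≈y (≈-sym (≈-anti g≤α y′≈y))))
          in ≈-trans (≈-sym x′≈x) (≈-trans (≈-anti (inj₁ α<γ) x′≈y′) y′≈y)

    -- The thread

    α₁ : Carrier
    α₁ = proj₁ separation

    opaque
      root : ∃[ x ] Thick α₁ x
      root = node-pigeonhole α₁ Path proj₁ paths-stationary

    x₁ : Subset
    x₁ = proj₁ root

    OnBranch : Carrier → Subset → Set (lsuc ℓ)
    OnBranch α x = α₁ ≤ α × Thick α x × x ≈[ α₁ ] x₁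

    branch : ∀ {α} → α₁ ≤ α → ∃[ x ] OnBranch α x
    branch α₁≤α = let x , thick , x≈x₁ = thick-extends α₁≤α (proj₂ root) in x , α₁≤α , thick , x≈x₁

    -- At the lower level both are thick and agree with `x₁` below `α₁`, so `separation` identifies
    -- them.
    branch-coheres : ∀ {α α′ x x′} → α ≤ α′ → OnBranch α x → OnBranch α′ x′ → x′ ≈[ α ] x
    branch-coheres α≤α′ (α₁≤α , thick , x≈x₁) (_ , thick′ , x′≈x₁) =
      proj₂ separation α₁≤α (thick-anti α≤α′ thick′) thick (≈-trans x′≈x₁ (≈-sym x≈x₁))

    -- The union of the branch. `OnBranch` lives one universe above a `Subset`, hence `Resize`.
    D : Subset
    D y = Resize ℓ (∃[ α ] ∃[ x ] OnBranch α x × y < α × x y)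

    D≈branch : ∀ {α x} → OnBranch α x → D ≈[ α ] x
    D≈branch {α} {x} on = agree to λ y<α xy → resize (_ , _ , on , y<α , xy)
      where
      to : ∀ {y} → y < α → D y → x y
      to y<α y∈D with unresize y∈D
      ... | α′ , x′ , on′ , y<α′ , x′y with ≤-total α α′
      ...   | inj₁ α≤α′ = ≈⇒ (branch-coheres α≤α′ on on′) y<α x′y
      ...   | inj₂ α′≤α = ≈⇐ (branch-coheres α′≤α on′ on) y<α′ x′y

    -- Agreement past `α` with a member of a later `𝒞 β` lets `D` inherit closure and coherence at
    -- `α` from that member.
    D≈member : ∀ α → ∃[ β ] α < β × (∃[ C ] C ∈ Member (𝒞 β) × (∃[ α′ ] α < α′ × D ≈[ α′ ] C))
    D≈member α =
      let α⁺ , α<α⁺ = no-max α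
          α′ , (α⁺≤α′ , α₁≤α′) , _ = max α⁺ α₁
          x , on@(_ , thick , _) = branch α₁≤α′
          β , α′<β , C , (C∈ , _) , C≈x = thick⇒path thick
          α<α′ = <-≤-trans α<α⁺ α⁺≤α′
      in β , <-trans α<α′ α′<β , C , C∈ , α′ , α<α′ , ≈-trans (D≈branch on) (≈-sym C≈x)

    -- Each path through `x₁` into a late `β` has an element from `γ′` on, and Fodor's lemma gives a
    -- common one, `y`, on a stationary set. A node shared by stationarily many of these paths is
    -- thick, lies on the branch and contains `y`.
    D-unbounded : ∀ γ → ∃[ y ] D y × γ ≤ y
    D-unbounded γ =
      let γ′ , (γ≤γ′ , α₁≤γ′) , _ = max γ α₁
          Through : Carrier → Carrier → Subset → Set (lsuc ℓ)
          Through y β C = (Path β C × C ≈[ α₁ ] x₁) × C y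
          y , stat = fodor (λ β y → γ′ ≤ y × ∃ (Through y β)) (stationary-above (proj₂ root) γ′)
            λ ((C , path@(C∈ , _) , C≈x₁) , γ′<β) →
              let y , Cy , γ′≤y = member-unbounded C∈ γ′<β
              in y , member-< C∈ Cy , γ′≤y , C , (path , C≈x₁) , Cy
          _ , _ , γ′≤y , _ = stationary-satisfiable stat
          -- A node at level `y` does not decide `y` itself, so a level above is taken.
          y⁺ , y<y⁺ = no-max y
          α₁≤y⁺ = ≤-trans α₁≤γ′ (≤-trans γ′≤y (inj₁ y<y⁺))
          z , stat-z = node-pigeonhole y⁺ (Through y) (proj₁ ∘ proj₁ ∘ proj₁)
            (stationary-mono (proj₂ ∘ proj₂) stat)
          _ , C , ((_ , C≈x₁) , Cy) , C≈z = stationary-satisfiable stat-z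
          on : OnBranch y⁺ z
          on = α₁≤y⁺ , stationary-mono (λ (C , ((path , _) , _) , C≈z) → C , path , C≈z) stat-z
             , ≈-trans (≈-sym (≈-anti α₁≤y⁺ C≈z)) C≈x₁
      in y , ≈⇐ (D≈branch on) y<y⁺ (≈⇒ C≈z y<y⁺ Cy) , ≤-trans γ≤γ′ γ′≤y

    D-isThread : IsThread 𝒞 D
    D-isThread = record
      { bounded = λ _ → [ _ ]<⊤⁺
      ; unbounded = λ γ _ → D-unbounded γ
      ; closed = λ γ _ (y , y∈D , y<γ) sup →
          let β , γ<β , C , C∈ , α′ , γ<α′ , D≈C = D≈member γ
              D∩γ≐C∩γ = ≈⇒∩-below-≐ (≈-anti (inj₁ γ<α′) D≈C)
          in ≈⇐ D≈C γ<α′ (IsClub.closed (clubs β C∈) γ [ γ<β ]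
               (y , proj₁ D∩γ≐C∩γ (y∈D , y<γ)) (IsSup-resp-≐ D∩γ≐C∩γ sup))
      } , λ {α} (_ , sup) →
        let β , α<β , C , C∈ , α′ , α<α′ , D≈C = D≈member α
            D∩α≐C∩α = ≈⇒∩-below-≐ (≈-anti (inj₁ α<α′) D≈C)
        in Collection.respects (𝒞 α) (proj₂ D∩α≐C∩α , proj₁ D∩α≐C∩α)
             (coherent β C∈ (member-unbounded C∈ α<β , IsSup-resp-≐ D∩α≐C∩α sup))

  -- The two stationary subsets of `S`

  nonreflecting-pair : ¬ (∃[ D ] IsThread 𝒞 D) → ∀ {S} → IsStationary ⊤⁺ S →
    ∃[ T₁ ] ∃[ T₂ ] (T₁ ⊆ S × IsStationary ⊤⁺ T₁) × (T₂ ⊆ S × IsStationary ⊤⁺ T₂) × ¬ (T₁ ≐ T₂) ×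
    ¬ (∃[ α ] ReflectsAt T₁ α × ReflectsAt T₂ α)
  nonreflecting-pair no-thread {S} S-stationary =
    let α , H , stat₁ , stat₂ = by-contradiction
          {P = ∃[ α ] ∃[ H ] Stationary (AllMeet α H) × Stationary (AllMiss α H)}
          λ none → no-thread (_ , Branch.D-isThread (stationary S-stationary)
            λ α H stat₁ stat₂ → none (α , H , stat₁ , stat₂))
        -- As `𝒞 β` is nonempty, a `β` in the first set cannot lie in the second, so the sets
        -- differ.
        β , Sβ , α<β , meets = stationary-satisfiable stat₁
        C , C∈ = nonempty β
    in (λ β → Resize ℓ (AllMeet α H β)) , (λ β → Resize ℓ (AllMiss α H β))
     , (proj₁ ∘ unresize , intersects (stationary-mono resize stat₁))
     , (proj₁ ∘ unresize , intersects (stationary-mono resize stat₂))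
     , (λ (T₁⊆T₂ , _) → proj₂ (proj₂ (unresize (T₁⊆T₂ (resize (Sβ , α<β , meets))))) C∈ (meets C∈))
     , separated-nonreflecting (proj₂ ∘ unresize) (proj₂ ∘ unresize)
    where
    AllMeet AllMiss : Carrier → List Subset → Pred Carrier (lsuc ℓ)
    AllMeet α H β = S β × α < β × (∀ {C} → C ∈ Member (𝒞 β) → Meets α H C)
    AllMiss α H β = S β × α < β × (∀ {C} → C ∈ Member (𝒞 β) → ¬ Meets α H C)

theorem2p6 : (∀ {a} → ExcludedMiddle a) →
    ∀ {ℓ : Level} (Λ : WellOrder ℓ) → IsRegularUncountable Λ →
    let open Combinatorics Λ in
    □< ω →
    ∀ (S : Subset) → IsStationary ⊤⁺ S →
    ¬ Refl 2 S ×
    (∃[ T₁ ] ∃[ T₂ ] (T₁ ⊆ S × IsStationary ⊤⁺ T₁) × (T₂ ⊆ S × IsStationary ⊤⁺ T₂) × ¬ (T₁ ≐ T₂) ×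
    ¬ (∃[ α ] ReflectsAt T₁ α × ReflectsAt T₂ α))
theorem2p6 em Λ regular (𝒞 , isCoherent , no-thread) S S-stationary =
  let pair@(_ , _ , T₁-ok , T₂-ok , _ , not-simultaneous) =
        Square.nonreflecting-pair em Λ regular 𝒞 isCoherent no-thread S-stationary
  in (λ reflects → not-simultaneous (OrderTheory.Refl-pair em Λ reflects T₁-ok T₂-ok)) , pair
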